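{- If the symmetric group $S_4$ acts on a finite set $X$, then $D_{S_4}(X)\in\{1,2,3,4\}$. If $S_4$ acts faithfully on $X$, then $D_{S_4}(X)\in\{2,3,4\}$.
   Context: For a group $\Gamma$ acting on a set $X$, write $g.x$ for the action and $\mathrm{Stab}_\Gamma(Y)=\{g\in\Gamma: g.y=y \text{ for all } y\in Y\}$. The action is faithful if $\mathrm{Stab}_\Gamma(X)$ is trivial. A labelling $\phi:X\to\{1,\dots,k\}$ is $k$-distinguishing if $\{g\in\Gamma:\phi(g.x)=\phi(x)\text{ for all }x\}=\mathrm{Stab}_\Gamma(X)$. The distinguishing number $D_\Gamma(X)$ is the minimum $k$ for which a $k$-distinguishing labelling exists. -}

module Defs where

open import Data.Nat using (ℕ; suc; _<_; _≤_)
open import Data.Fin using (Fin)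
open import Data.Fin.Permutation using (Permutation′; _⟨$⟩ʳ_; _∘ₚ_; id; _≈_)
open import Data.Product using (Σ; _×_; ∃)
open import Relation.Binary.PropositionalEquality using (_≡_)
open import Relation.Nullary using (¬_)
open import Function.Bundles using (_⇔_)

-- The symmetric group S₄: permutations of a 4-element set, with
-- equality _≈_ (pointwise) and product  g·h = "h then g" = h ∘ₚ g.
S₄ : Set
S₄ = Permutation′ 4

record IsAction {n : ℕ} (act : S₄ → Fin n → Fin n) : Set where
  field
    act-resp : ∀ {g h} → g ≈ h → ∀ x → act g x ≡ act h x
    act-id   : ∀ x → act id x ≡ x
    act-comp : ∀ g h x → act (h ∘ₚ g) x ≡ act g (act h x)

InStab : {n : ℕ} → (S₄ → Fin n → Fin n) → S₄ → Set
InStab act g = ∀ x → act g x ≡ x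

Faithful : {n : ℕ} → (S₄ → Fin n → Fin n) → Set
Faithful act = ∀ g → InStab act g → g ≈ id

IsDistinguishing : {n : ℕ} → (S₄ → Fin n → Fin n) → (k : ℕ) → (Fin n → Fin k) → Set
IsDistinguishing act k φ = ∀ g → (∀ x → φ (act g x) ≡ φ x) ⇔ InStab act g

HasDistinguishing : {n : ℕ} → (S₄ → Fin n → Fin n) → ℕ → Set
HasDistinguishing {n} act k = Σ (Fin n → Fin k) (IsDistinguishing act k)

IsDistNumber : {n : ℕ} → (S₄ → Fin n → Fin n) → ℕ → Set
IsDistNumber act k =
  1 ≤ k × HasDistinguishing act k × (∀ j → 1 ≤ j → j < k → ¬ HasDistinguishing act j)

{-# OPTIONS --safe #-}

-- Three points x, y, z whose common stabiliser is the kernel K of the action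
-- give a 4-distinguishing labelling: colour them 1, 2, 3 and everything else 0.
-- Let V be the Klein four-group and H the stabiliser of x.
--   * If H ∩ V = 1, take y = v x and z = w x with v, w generating V: for h fixing
--     all three points, [h , v] and [h , w] lie in H ∩ V = 1, so h centralises V;
--     hence h ∈ V ∩ H = 1.
--   * If H ∩ V = {1 , u}, then H centralises u; for a 3-cycle c and y = c x,
--     an h fixing x and y centralises two involutions of V, so h ∈ {1 , u},
--     and u does not fix y.
--   * If V ⊆ K, the action is one of S₄/V ≅ S₃, for which x and c x suffice if
--     c x ≢ x for some x, and otherwise a single point does.
-- Labellings and group elements can be enumerated, so the least number of
-- colours can be found by search.
module Submission where

open import Defs
open import Data.Nat using (ℕ; suc; _≤_; _<_; z≤n; s≤s)
open import Data.Fin using (Fin; zero; suc; toℕ; fromℕ<; Fin′; inject; finToFun; funToFin)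
open import Data.Fin.Patterns using (0F; 1F; 2F; 3F)
open import Data.Fin.Permutation using (_⟨$⟩ʳ_; _∘ₚ_; id; flip; transpose; _≈_; inverseˡ)
open import Data.Fin.Properties using (_≟_; all?; any?; ¬∀⟶∃¬-smallest; toℕ<n; toℕ-fromℕ<; toℕ-inject; finToFun-funToFin)
open import Data.Product using (Σ; ∃; ∃₂; _×_; _,_)
open import Data.Sum using (_⊎_; inj₁; inj₂)
open import Function.Base using (_∘_)
open import Function.Bundles using (Injection; Equivalence; mk⇔)
open import Function.Properties.Inverse using (↔⇒↣)
open import Relation.Binary.Definitions using (_Respects_)
open import Relation.Binary.PropositionalEquality using (_≡_; _≢_; _≗_; refl; sym; trans; cong; subst; module ≡-Reasoning)
open import Relation.Nullary using (¬_; Dec; yes; no; contradiction)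
open import Relation.Nullary.Decidable using (map′; ¬?; _×-dec_; _⊎-dec_; _→-dec_; from-yes; decidable-stable)
open import Relation.Unary using (Decidable)

-- Normal forms in `S₄`.

infix 4 _≈?_

_≈?_ : (g h : S₄) → Dec (g ≈ h)
g ≈? h = all? λ i → (g ⟨$⟩ʳ i) ≟ (h ⟨$⟩ʳ i)

klein : Fin 4 → S₄
klein 0F = id
klein 1F = transpose 0F 1F ∘ₚ transpose 2F 3F
klein 2F = transpose 0F 2F ∘ₚ transpose 1F 3F
klein 3F = transpose 0F 3F ∘ₚ transpose 1F 2F

τ c : S₄
τ = transpose 0F 1F
c = transpose 0F 1F ∘ₚ transpose 1F 2F

c^ : Fin 3 → S₄
c^ 0F = id
c^ 1F = c
c^ 2F = c ∘ₚ c

τ^ : Fin 2 → S₄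
τ^ 0F = id
τ^ 1F = τ

-- S₄ = V ⋊ (C₃ ⋊ C₂)
normalForm : Fin 4 → Fin 3 → Fin 2 → S₄
normalForm i j k = klein i ∘ₚ (c^ j ∘ₚ τ^ k)

-- Abstract, like the checks below, so that the case tables are not unfolded later.
abstract
  values-normalForm : ∀ a₀ a₁ a₂ a₃ →
    a₀ ≢ a₁ × a₀ ≢ a₂ × a₀ ≢ a₃ × a₁ ≢ a₂ × a₁ ≢ a₃ × a₂ ≢ a₃ →
    ∃ λ i → ∃₂ λ j k → let h = normalForm i j k in
      a₀ ≡ h ⟨$⟩ʳ 0F × a₁ ≡ h ⟨$⟩ʳ 1F × a₂ ≡ h ⟨$⟩ʳ 2F × a₃ ≡ h ⟨$⟩ʳ 3F
  values-normalForm = from-yes (all? λ a₀ → all? λ a₁ → all? λ a₂ → all? λ a₃ →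
    (¬? (a₀ ≟ a₁) ×-dec ¬? (a₀ ≟ a₂) ×-dec ¬? (a₀ ≟ a₃) ×-dec
     ¬? (a₁ ≟ a₂) ×-dec ¬? (a₁ ≟ a₃) ×-dec ¬? (a₂ ≟ a₃)) →-dec
    any? λ i → any? λ j → any? λ k → let h = normalForm i j k in
      (a₀ ≟ (h ⟨$⟩ʳ 0F)) ×-dec (a₁ ≟ (h ⟨$⟩ʳ 1F)) ×-dec
      (a₂ ≟ (h ⟨$⟩ʳ 2F)) ×-dec (a₃ ≟ (h ⟨$⟩ʳ 3F)))

-- A permutation is determined up to `_≈_` by its four pairwise distinct values, so a check over
-- 4-tuples of points reaches every `g`.
normalForm-surjective : ∀ g → ∃ λ i → ∃₂ λ j k → g ≈ normalForm i j k
normalForm-surjective g =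
  let i , j , k , e₀ , e₁ , e₂ , e₃ = values-normalForm
        (g ⟨$⟩ʳ 0F) (g ⟨$⟩ʳ 1F) (g ⟨$⟩ʳ 2F) (g ⟨$⟩ʳ 3F)
        (apart (λ ()) , apart (λ ()) , apart (λ ()) , apart (λ ()) , apart (λ ()) , apart (λ ()))
  in i , j , k , λ { 0F → e₀ ; 1F → e₁ ; 2F → e₂ ; 3F → e₃ }
  where
  apart : ∀ {a b} → a ≢ b → (g ⟨$⟩ʳ a) ≢ (g ⟨$⟩ʳ b)
  apart a≢b = a≢b ∘ Injection.injective (↔⇒↣ g)

-- Reduces a question about `S₄` to 24 cases; invariance under `_≈_` enters because `g` agrees with
-- its normal form only pointwise.
∀S₄? : {P : S₄ → Set} → P Respects _≈_ → Decidable P → Dec (∀ g → P g)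
∀S₄? {P} resp P? = map′
  (λ all g → let i , j , k , g≈ = normalForm-surjective g in
    resp {normalForm i j k} {g} (λ a → sym (g≈ a)) (all i j k))
  (λ all i j k → all (normalForm i j k))
  (all? λ i → all? λ j → all? λ k → P? (normalForm i j k))

-- _∘ₚ_ composes from left to right: as functions, conj h g is g⁻¹ h g, and comm h g
-- is g⁻¹ h g h⁻¹.
conj : S₄ → S₄ → S₄
conj h g = g ∘ₚ (h ∘ₚ flip g)

comm : S₄ → S₄ → S₄
comm h g = flip h ∘ₚ conj h g

-- Finite checks on `V` and its complement `S₃`.

abstract

  -- `V` is normal, so both commutators lie in it. If both are trivial, `h` centralises two
  -- generators of `V`, and `V` is its own centraliser in `S₄`.
  klein-self-centralising : ∀ i j k → let h = normalForm i j k in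
    h ≈ id ⊎ ∃ λ m → h ≈ klein (suc m) ⊎
      comm h (klein 1F) ≈ klein (suc m) ⊎ comm h (klein 2F) ≈ klein (suc m)
  klein-self-centralising = from-yes (all? λ i → all? λ j → all? λ k →
    let h = normalForm i j k in
    (h ≈? id) ⊎-dec any? λ m → (h ≈? klein (suc m)) ⊎-dec
      (comm h (klein 1F) ≈? klein (suc m)) ⊎-dec (comm h (klein 2F) ≈? klein (suc m)))

  -- Both conjugates of `klein (suc u)` lie in `V`. If neither differs from `klein (suc u)`, then
  -- `h` centralises two involutions of `V` and so lies in `V`. The alternative `conj h c` disposes
  -- of `h ≈ klein (suc u)`, as `c` permutes the three involutions cyclically.
  involution-centralisers : ∀ u i j k → let h = normalForm i j k in
    h ≈ id ⊎ ∃ λ m → m ≢ u × (h ≈ klein (suc m) ⊎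
      conj (klein (suc u)) h ≈ klein (suc m) ⊎
      conj h c ≈ klein (suc m) ⊎
      conj (klein (suc u)) (conj h c) ≈ klein (suc m))
  involution-centralisers = from-yes (all? λ u → all? λ i → all? λ j → all? λ k →
    let h = normalForm i j k in
    (h ≈? id) ⊎-dec any? λ m → ¬? (m ≟ u) ×-dec ((h ≈? klein (suc m)) ⊎-dec
      (conj (klein (suc u)) h ≈? klein (suc m)) ⊎-dec
      (conj h c ≈? klein (suc m)) ⊎-dec
      (conj (klein (suc u)) (conj h c) ≈? klein (suc m))))

  klein-two-generated : ∀ u m l → m ≢ u →
    klein (suc l) ≈ klein (suc u) ⊎ klein (suc l) ≈ klein (suc m) ⊎
    klein (suc l) ≈ klein (suc u) ∘ₚ klein (suc m)
  klein-two-generated = from-yes (all? λ u → all? λ m → all? λ l → ¬? (m ≟ u) →-dec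
    ((klein (suc l) ≈? klein (suc u)) ⊎-dec (klein (suc l) ≈? klein (suc m)) ⊎-dec
     (klein (suc l) ≈? klein (suc u) ∘ₚ klein (suc m))))

  -- A nontrivial rotation is `c` or its inverse; a reflection inverts `c`, so its commutator with
  -- `c` is again a nontrivial rotation.
  S₃-base : ∀ j k → let s = c^ j ∘ₚ τ^ k in
    s ≈ id ⊎ c ≈ s ⊎ c ≈ flip s ⊎ c ≈ comm s c ⊎ c ≈ flip (comm s c)
  S₃-base = from-yes (all? λ j → all? λ k → let s = c^ j ∘ₚ τ^ k in
    (s ≈? id) ⊎-dec (c ≈? s) ⊎-dec (c ≈? flip s) ⊎-dec (c ≈? comm s c) ⊎-dec
    (c ≈? flip (comm s c)))

-- Labelling by three marked points.

label₃ : {n : ℕ} → Fin n → Fin n → Fin n → Fin n → Fin 4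
label₃ x y z w with w ≟ x | w ≟ y | w ≟ z
... | yes _ | _     | _     = 1F
... | no _  | yes _ | _     = 2F
... | no _  | no _  | yes _ = 3F
... | no _  | no _  | no _  = 0F

module _ {n : ℕ} (x y z : Fin n) where

  -- The first successful test wins, so even if `x`, `y`, `z` coincide a nonzero colour marks a
  -- single point. Hence preserving the labelling forces fixing each marked point.
  label₃-injective : ∀ {a} → label₃ x y z a ≢ 0F → ∀ w → label₃ x y z w ≡ label₃ x y z a → w ≡ a
  label₃-injective {a} ≢0 w eq with a ≟ x | a ≟ y | a ≟ z | w ≟ x | w ≟ y | w ≟ z
  ... | yes refl | _        | _        | yes refl | _        | _        = refl
  ... | no _     | yes refl | _        | no _     | yes refl | _        = refl
  ... | no _     | no _     | yes refl | no _     | no _     | yes refl = refl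
  ... | no _     | no _     | no _     | _        | _        | _        = contradiction refl ≢0
  ... | yes _    | _        | _        | no _     | yes _    | _        = contradiction eq λ ()
  ... | yes _    | _        | _        | no _     | no _     | yes _    = contradiction eq λ ()
  ... | yes _    | _        | _        | no _     | no _     | no _     = contradiction eq λ ()
  ... | no _     | yes _    | _        | yes _    | _        | _        = contradiction eq λ ()
  ... | no _     | yes _    | _        | no _     | no _     | yes _    = contradiction eq λ ()
  ... | no _     | yes _    | _        | no _     | no _     | no _     = contradiction eq λ ()
  ... | no _     | no _     | yes _    | yes _    | _        | _        = contradiction eq λ ()
  ... | no _     | no _     | yes _    | no _     | yes _    | _        = contradiction eq λ ()
  ... | no _     | no _     | yes _    | no _     | no _     | no _     = contradiction eq λ ()

  label₃-x≢0 : label₃ x y z x ≢ 0F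
  label₃-x≢0 with x ≟ x | x ≟ y | x ≟ z
  ... | yes _  | _ | _ = λ ()
  ... | no x≢x | _ | _ = contradiction refl x≢x

  label₃-y≢0 : label₃ x y z y ≢ 0F
  label₃-y≢0 with y ≟ x | y ≟ y | y ≟ z
  ... | yes _ | _      | _ = λ ()
  ... | no _  | yes _  | _ = λ ()
  ... | no _  | no y≢y | _ = contradiction refl y≢y

  label₃-z≢0 : label₃ x y z z ≢ 0F
  label₃-z≢0 with z ≟ x | z ≟ y | z ≟ z
  ... | yes _ | _     | _      = λ ()
  ... | no _  | yes _ | _      = λ ()
  ... | no _  | no _  | yes _  = λ ()
  ... | no _  | no _  | no z≢z = contradiction refl z≢z

-- Functions are searched through their codes in a finite set; decoding recovers `f` only pointwise,
-- whence the invariance under `_≗_`.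
∃Fun? : ∀ {m k} {P : (Fin m → Fin k) → Set} → P Respects _≗_ → Decidable P → Dec (∃ P)
∃Fun? resp P? = map′
  (λ (i , p) → finToFun i , p)
  (λ (f , p) → funToFin f , resp (λ a → sym (finToFun-funToFin f a)) p)
  (any? (P? ∘ finToFun))

-- Fixed points and bases of an action.

module _ {n : ℕ} {act : S₄ → Fin n → Fin n} (isAction : IsAction act) where
  open IsAction isAction

  Fixes : S₄ → Fin n → Set
  Fixes g x = act g x ≡ x

  Fixes-resp-≈ : ∀ {g h x} → g ≈ h → Fixes h x → Fixes g x
  Fixes-resp-≈ {g} {h} {x} g≈h hx = trans (act-resp {g} {h} g≈h x) hx

  Fixes-id : ∀ {g x} → g ≈ id → Fixes g x
  Fixes-id {g} {x} g≈id = Fixes-resp-≈ {g} {id} g≈id (act-id x)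

  Fixes-∘ : ∀ {g h x} → Fixes g x → Fixes h x → Fixes (g ∘ₚ h) x
  Fixes-∘ {g} {h} {x} gx hx = trans (act-comp h g x) (trans (cong (act h) gx) hx)

  act-flip-act : ∀ g x → act (flip g) (act g x) ≡ x
  act-flip-act g x = trans (sym (act-comp (flip g) g x))
    (Fixes-id {g ∘ₚ flip g} (λ _ → inverseˡ g))

  Fixes-flip : ∀ {g x} → Fixes g x → Fixes (flip g) x
  Fixes-flip {g} {x} gx = trans (cong (act (flip g)) (sym gx)) (act-flip-act g x)

  -- The stabilisers of `x` and `act g x` are conjugate by `g`; this carries conditions at other
  -- base points back to `x`.
  Fixes-conj : ∀ {h g x} → Fixes h (act g x) → Fixes (conj h g) x
  Fixes-conj {h} {g} {x} hgx = begin
    act (conj h g) x               ≡⟨ act-comp (h ∘ₚ flip g) g x ⟩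
    act (h ∘ₚ flip g) (act g x)    ≡⟨ act-comp (flip g) h (act g x) ⟩
    act (flip g) (act h (act g x)) ≡⟨ cong (act (flip g)) hgx ⟩
    act (flip g) (act g x)         ≡⟨ act-flip-act g x ⟩
    x                              ∎
    where open ≡-Reasoning

  Fixes-conj′ : ∀ {h g x} → Fixes h x → Fixes g x → Fixes (conj h g) x
  Fixes-conj′ {h} {g} {x} hx gx = Fixes-conj {h} {g} (subst (Fixes h) (sym gx) hx)

  Fixes-comm : ∀ {h g x} → Fixes h x → Fixes h (act g x) → Fixes (comm h g) x
  Fixes-comm {h} {g} hx hgx = Fixes-∘ {flip h} {conj h g} (Fixes-flip {h} hx) (Fixes-conj {h} {g} hgx)

  -- A base modulo the kernel of the action. Points may repeat, so cases with one or two points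
  -- share this form.
  IsBase : Fin n → Fin n → Fin n → Set
  IsBase x y z = ∀ g → Fixes g x → Fixes g y → Fixes g z → InStab act g

  isBase-normalForm : ∀ {x y z} →
    (∀ i j k → let h = normalForm i j k in Fixes h x → Fixes h y → Fixes h z → InStab act h) →
    IsBase x y z
  isBase-normalForm {x} {y} {z} base g gx gy gz w =
    let i , j , k , g≈h = normalForm-surjective g
        h = normalForm i j k
        h≈g : h ≈ g
        h≈g a = sym (g≈h a)
    in Fixes-resp-≈ {g} {h} g≈h (base i j k
         (Fixes-resp-≈ {h} {g} h≈g gx) (Fixes-resp-≈ {h} {g} h≈g gy) (Fixes-resp-≈ {h} {g} h≈g gz) w)

  -- Nontrivial action of the Klein four-group.

  klein-regular⇒base : ∀ {x} → (∀ m → ¬ Fixes (klein (suc m)) x) →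
    IsBase x (act (klein 1F) x) (act (klein 2F) x)
  klein-regular⇒base {x} moved = isBase-normalForm base
    where
    base : ∀ i j k → let h = normalForm i j k in
      Fixes h x → Fixes h (act (klein 1F) x) → Fixes h (act (klein 2F) x) → InStab act h
    base i j k hx hy hz w with klein-self-centralising i j k
    ... | inj₁ h≈id = Fixes-id {normalForm i j k} h≈id
    ... | inj₂ (m , k∈V) = contradiction (fixed k∈V) (moved m)
      where
      h = normalForm i j k
      resp : ∀ {g} → g ≈ klein (suc m) → Fixes g x → Fixes (klein (suc m)) x
      resp {g} g≈ = Fixes-resp-≈ {klein (suc m)} {g} (λ a → sym (g≈ a))
      fixed : h ≈ klein (suc m) ⊎ comm h (klein 1F) ≈ klein (suc m) ⊎
              comm h (klein 2F) ≈ klein (suc m) → Fixes (klein (suc m)) x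
      fixed (inj₁ e)        = resp {h} e hx
      fixed (inj₂ (inj₁ e)) = resp {comm h (klein 1F)} e (Fixes-comm {h} {klein 1F} hx hy)
      fixed (inj₂ (inj₂ e)) = resp {comm h (klein 2F)} e (Fixes-comm {h} {klein 2F} hx hz)

  klein-involution⇒base : ∀ {x u} → Fixes (klein (suc u)) x →
    (∀ m → m ≢ u → ¬ Fixes (klein (suc m)) x) → IsBase x (act c x) x
  klein-involution⇒base {x} {u} ux moved = isBase-normalForm base
    where
    base : ∀ i j k → let h = normalForm i j k in
      Fixes h x → Fixes h (act c x) → Fixes h x → InStab act h
    base i j k hx hy _ w with involution-centralisers u i j k
    ... | inj₁ h≈id = Fixes-id {normalForm i j k} h≈id
    ... | inj₂ (m , m≢u , k∈V) = contradiction (fixed k∈V) (moved m m≢u)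
      where
      h = normalForm i j k
      v = klein (suc u)
      resp : ∀ {g} → g ≈ klein (suc m) → Fixes g x → Fixes (klein (suc m)) x
      resp {g} g≈ = Fixes-resp-≈ {klein (suc m)} {g} (λ a → sym (g≈ a))
      h′x : Fixes (conj h c) x
      h′x = Fixes-conj {h} {c} hy
      fixed : h ≈ klein (suc m) ⊎ conj v h ≈ klein (suc m) ⊎ conj h c ≈ klein (suc m) ⊎
              conj v (conj h c) ≈ klein (suc m) → Fixes (klein (suc m)) x
      fixed (inj₁ e)               = resp {h} e hx
      fixed (inj₂ (inj₁ e))        = resp {conj v h} e (Fixes-conj′ {v} {h} ux hx)
      fixed (inj₂ (inj₂ (inj₁ e))) = resp {conj h c} e h′x
      fixed (inj₂ (inj₂ (inj₂ e))) = resp {conj v (conj h c)} e (Fixes-conj′ {v} {conj h c} ux h′x)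

  klein-moves⇒base : ∀ {x m} → ¬ Fixes (klein (suc m)) x → ∃₂ (IsBase x)
  klein-moves⇒base {x} {l} lx with any? (λ u → act (klein (suc u)) x ≟ x)
  ... | no none      = _ , _ , klein-regular⇒base λ m mx → none (m , mx)
  -- A second involution fixing `x` would generate `V` together with `klein (suc u)`, and then
  -- `klein (suc l)` would fix `x`.
  ... | yes (u , ux) = _ , _ , klein-involution⇒base ux λ m m≢u mx → lx (fixed m mx (klein-two-generated u m l m≢u))
    where
    fixed : ∀ m → Fixes (klein (suc m)) x →
      klein (suc l) ≈ klein (suc u) ⊎ klein (suc l) ≈ klein (suc m) ⊎
      klein (suc l) ≈ klein (suc u) ∘ₚ klein (suc m) → Fixes (klein (suc l)) x
    fixed m mx (inj₁ e)        = Fixes-resp-≈ {klein (suc l)} {klein (suc u)} e ux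
    fixed m mx (inj₂ (inj₁ e)) = Fixes-resp-≈ {klein (suc l)} {klein (suc m)} e mx
    fixed m mx (inj₂ (inj₂ e)) = Fixes-resp-≈ {klein (suc l)} {klein (suc u) ∘ₚ klein (suc m)} e
      (Fixes-∘ {klein (suc u)} {klein (suc m)} ux mx)

  -- Actions factoring through `S₄/V`.

  module _ (kleinFixes : ∀ m → InStab act (klein (suc m))) where

    klein-trivial : ∀ i → InStab act (klein i)
    klein-trivial zero    = act-id
    klein-trivial (suc m) = kleinFixes m

    act-normalForm : ∀ i j k w → act (normalForm i j k) w ≡ act (c^ j ∘ₚ τ^ k) w
    act-normalForm i j k w = trans (act-comp (c^ j ∘ₚ τ^ k) (klein i) w)
      (cong (act (c^ j ∘ₚ τ^ k)) (klein-trivial i w))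

    c-moves⇒base : ∀ {x} → ¬ Fixes c x → IsBase x (act c x) x
    c-moves⇒base {x} cx = isBase-normalForm base
      where
      base : ∀ i j k → let h = normalForm i j k in
        Fixes h x → Fixes h (act c x) → Fixes h x → InStab act h
      base i j k hx hy _ w with S₃-base j k
      ... | inj₁ s≈id = trans (act-normalForm i j k w) (Fixes-id {c^ j ∘ₚ τ^ k} s≈id)
      ... | inj₂ c∈⟨s⟩ = contradiction (fixed c∈⟨s⟩) cx
        where
        s = c^ j ∘ₚ τ^ k
        sx : Fixes s x
        sx = trans (sym (act-normalForm i j k x)) hx
        s′x : Fixes (comm s c) x
        s′x = Fixes-comm {s} {c} sx (trans (sym (act-normalForm i j k (act c x))) hy)
        fixed : c ≈ s ⊎ c ≈ flip s ⊎ c ≈ comm s c ⊎ c ≈ flip (comm s c) → Fixes c x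
        fixed (inj₁ e)               = Fixes-resp-≈ {c} {s} e sx
        fixed (inj₂ (inj₁ e))        = Fixes-resp-≈ {c} {flip s} e (Fixes-flip {s} sx)
        fixed (inj₂ (inj₂ (inj₁ e))) = Fixes-resp-≈ {c} {comm s c} e s′x
        fixed (inj₂ (inj₂ (inj₂ e))) = Fixes-resp-≈ {c} {flip (comm s c)} e (Fixes-flip {comm s c} s′x)

    module _ (cFixes : InStab act c) where

      -- `V` and `c` generate the alternating group, so the action factors through the sign.
      act-normalForm-τ : ∀ i j k w → act (normalForm i j k) w ≡ act (τ^ k) w
      act-normalForm-τ i j k w = trans (act-normalForm i j k w)
        (trans (act-comp (τ^ k) (c^ j) w) (cong (act (τ^ k)) (c^-trivial j)))
        where
        c^-trivial : ∀ j → act (c^ j) w ≡ w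
        c^-trivial 0F = act-id w
        c^-trivial 1F = cFixes w
        c^-trivial 2F = Fixes-∘ {c} {c} (cFixes w) (cFixes w)

      τ-moves⇒base : ∀ {x} → ¬ Fixes τ x → IsBase x x x
      τ-moves⇒base {x} τx = isBase-normalForm base
        where
        base : ∀ i j k → let h = normalForm i j k in
          Fixes h x → Fixes h x → Fixes h x → InStab act h
        base i j 0F _  _ _ w = trans (act-normalForm-τ i j 0F w) (act-id w)
        base i j 1F hx _ _ w = contradiction (trans (sym (act-normalForm-τ i j 1F x)) hx) τx

      generators-trivial⇒trivial : InStab act τ → ∀ g → InStab act g
      generators-trivial⇒trivial τFixes g w =
        let i , j , k , g≈h = normalForm-surjective g
        in Fixes-resp-≈ {g} {normalForm i j k} g≈h (trans (act-normalForm-τ i j k w) (τ^-trivial k))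
        where
        τ^-trivial : ∀ k → act (τ^ k) w ≡ w
        τ^-trivial 0F = act-id w
        τ^-trivial 1F = τFixes w

  -- Four colours suffice.

  moves? : ∀ g → (∃ λ x → ¬ Fixes g x) ⊎ InStab act g
  moves? g with any? (λ x → ¬? (act g x ≟ x))
  ... | yes moved = inj₁ moved
  ... | no none   = inj₂ λ x → decidable-stable (act g x ≟ x) λ gx → none (x , gx)

  klein-moves? : (∃₂ λ m x → ¬ Fixes (klein (suc m)) x) ⊎ (∀ m → InStab act (klein (suc m)))
  klein-moves? with any? (λ m → any? λ x → ¬? (act (klein (suc m)) x ≟ x))
  ... | yes moved = inj₁ moved
  ... | no none   = inj₂ λ m x → decidable-stable (act (klein (suc m)) x ≟ x) λ mx → none (m , x , mx)

  -- Climbs the chain `1 < V < A₄ < S₄`: the first layer that moves a point supplies the base.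
  base-or-trivial : (∃ λ x → ∃₂ (IsBase x)) ⊎ (∀ g → InStab act g)
  base-or-trivial with klein-moves? | moves? c | moves? τ
  ... | inj₁ (m , x , mx) | _             | _             = inj₁ (x , klein-moves⇒base {m = m} mx)
  ... | inj₂ V            | inj₁ (x , cx) | _             = inj₁ (x , _ , _ , c-moves⇒base V cx)
  ... | inj₂ V            | inj₂ C        | inj₁ (x , τx) = inj₁ (x , _ , _ , τ-moves⇒base V C τx)
  ... | inj₂ V            | inj₂ C        | inj₂ T        = inj₂ (generators-trivial⇒trivial V C T)

  hasDistinguishing₄ : HasDistinguishing act 4
  hasDistinguishing₄ with base-or-trivial
  ... | inj₁ (x , y , z , base) = label₃ x y z , λ g → mk⇔
    (λ pres → base g
      (label₃-injective x y z (label₃-x≢0 x y z) (act g x) (pres x))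
      (label₃-injective x y z (label₃-y≢0 x y z) (act g y) (pres y))
      (label₃-injective x y z (label₃-z≢0 x y z) (act g z) (pres z)))
    (λ stab w → cong (label₃ x y z) (stab w))
  -- For a trivial action any labelling works; this case includes `n ≡ 0`.
  ... | inj₂ trivial = (λ _ → 0F) , λ g → mk⇔ (λ _ → trivial g) (λ _ _ → refl)

  -- The least number of colours.

  isDistinguishing? : ∀ {k} → Decidable (IsDistinguishing act k)
  -- Elements acting trivially preserve every labelling, so only the forward implication has to be
  -- decided.
  isDistinguishing? φ = map′
    (λ dist g → mk⇔ (dist g) (λ stab x → cong φ (stab x)))
    (λ dist g → Equivalence.to (dist g))
    (∀S₄? {λ g → (∀ x → φ (act g x) ≡ φ x) → InStab act g}
      (λ {g} {h} g≈h dist pres x → trans (sym (act-resp {g} {h} g≈h x))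
        (dist (λ y → trans (cong φ (act-resp {g} {h} g≈h y)) (pres y)) x))
      (λ g → (all? λ x → φ (act g x) ≟ φ x) →-dec (all? λ x → act g x ≟ x)))

  isDistinguishing-resp-≗ : ∀ {k} → IsDistinguishing act k Respects _≗_
  isDistinguishing-resp-≗ {k} {φ} {ψ} φ≗ψ dist g = mk⇔
    (λ pres → Equivalence.to (dist g) λ x →
      trans (φ≗ψ (act g x)) (trans (pres x) (sym (φ≗ψ x))))
    (λ stab x → cong ψ (stab x))

  hasDistinguishing? : Decidable (HasDistinguishing act)
  hasDistinguishing? k = ∃Fun? isDistinguishing-resp-≗ isDistinguishing?

  faithful⇒¬hasDistinguishing₁ : Faithful act → ¬ HasDistinguishing act 1
  faithful⇒¬hasDistinguishing₁ faithful (φ , dist) =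
    -- One colour is preserved by `τ`, which would then act trivially and, by faithfulness, fix
    -- `0F`.
    contradiction (faithful τ (Equivalence.to (dist τ) λ x → unique (φ (act τ x)) (φ x)) 0F) λ ()
    where
    unique : (a b : Fin 1) → a ≡ b
    unique 0F 0F = refl

  isDistNumber≤4 : ∃ λ (i : Fin 4) → IsDistNumber act (suc (toℕ i))
  -- Index `i` stands for `suc (toℕ i)` colours, so the search starts at one colour and stops by
  -- `3F`.
  isDistNumber≤4 = least (¬∀⟶∃¬-smallest 4 Lacks (λ i → ¬? (hasDistinguishing? (suc (toℕ i))))
                           (λ lacks → lacks 3F hasDistinguishing₄))
    where
    Lacks : Fin 4 → Set
    Lacks i = ¬ HasDistinguishing act (suc (toℕ i))

    least : (∃ λ i → ¬ Lacks i × ((j : Fin′ i) → Lacks (inject j))) →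
            ∃ λ i → IsDistNumber act (suc (toℕ i))
    least (i , has , smaller) =
      i , s≤s z≤n , decidable-stable (hasDistinguishing? _) has , minimal
      where
      minimal : ∀ j → 1 ≤ j → j < suc (toℕ i) → ¬ HasDistinguishing act j
      minimal (suc j) _ (s≤s j<i) =
        subst (λ l → ¬ HasDistinguishing act (suc l))
          (trans (toℕ-inject (fromℕ< j<i)) (toℕ-fromℕ< j<i)) (smaller (fromℕ< j<i))

theorem3p1 : (n : ℕ) (act : S₄ → Fin n → Fin n) → IsAction act →
    Σ ℕ (λ k → IsDistNumber act k × 1 ≤ k × k ≤ 4 × (Faithful act → 2 ≤ k))
theorem3p1 n act isAction = bounds (isDistNumber≤4 isAction)
  where
  bounds : (∃ λ (i : Fin 4) → IsDistNumber act (suc (toℕ i))) →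
    Σ ℕ (λ k → IsDistNumber act k × 1 ≤ k × k ≤ 4 × (Faithful act → 2 ≤ k))
  -- `zero` means one colour, impossible for a faithful action; `suc i` means at least two.
  bounds (zero , dist@(1≤k , has₁ , _)) = 1 , dist , 1≤k , toℕ<n {4} zero , λ faithful →
    contradiction has₁ (faithful⇒¬hasDistinguishing₁ isAction faithful)
  bounds (suc i , dist@(1≤k , _)) = _ , dist , 1≤k , toℕ<n (suc i) , λ _ → s≤s (s≤s z≤n)
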